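{- Let $G$ be a finite graph and $k>2$ an integer, and let $\mathcal P_k^*$ be any uncrossing of $\mathcal P_k$ (with respect to $\vec S=\vec S_k$). Then exactly one of the following holds: (i) $G$ has a $k$-profile; (ii) $G$ has an $S_k$-tree over $\overline{\mathcal P_k^*}$.
   Context: Separations of $G=(V,E)$: sets $\{A,B\}$ with $A\cup B=V$ and no edge between $A\setminus B$ and $B\setminus A$; orientations $(A,B),(B,A)$. The set $\vec U$ of oriented separations is ordered by $(A,B)\le(C,D)$ iff $A\subseteq C$, $B\supseteq D$, with involution $(A,B)^*=(B,A)$, join $(A\cup C,B\cap D)$, meet $(A\cap C,B\cup D)$; write $\overleftarrow s:=\vec s^{\,*}$. Order of $(A,B)$: $|A\cap B|$; $\vec S_k$: oriented separations of order $<k$; $S_k$ the corresponding separations. $\mathcal P$: all sets $\{(A,B),(C,D),(B\cap D,A\cup C)\}\subseteq\vec U$; $\mathcal P_k:=\mathcal P\cap2^{\vec S_k}$. An orientation of $S_k$ is a subset of $\vec S_k$ containing exactly one orientation of each element of $S_k$; it is consistent if it contains no $\overleftarrow r,\vec s$ with $r\ne s$, $\vec r<\vec s$. A $k$-profile is a consistent orientation of $S_k$ with no subset in $\mathcal P$. Degenerate: $\vec s=\overleftarrow s$; small: $\vec s\le\overleftarrow s$; $\vec r\in\vec S$ trivial in $\vec S$: $\vec r<\vec s$ and $\vec r<\overleftarrow s$ for some $\vec s\in\vec S$; star: a set of nondegenerate oriented separations with $\vec r\le\overleftarrow s$ for all distinct members. Uncrossing (for $\vec S=\vec S_k$): replacing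 two members $\vec x_1,\vec x_2$ of $\sigma\subseteq\vec S$ by $\{\vec x_1\wedge\overleftarrow x_2,\vec x_2\}$ (if $\vec x_1\wedge\overleftarrow x_2\in\vec S$) or by $\{\vec x_1,\vec x_2\wedge\overleftarrow x_1\}$ (if $\vec x_2\wedge\overleftarrow x_1\in\vec S$); a star obtained from $\sigma$ by finitely many such steps is obtained by uncrossing $\sigma$; an uncrossing of $\mathcal F\subseteq2^{\vec S}$ is a family $\mathcal F^*$ of stars, each obtained by uncrossing some member of $\mathcal F$, such that every member of $\mathcal F$ has some element of $\mathcal F^*$ obtained by uncrossing it. Shifting: for nontrivial nondegenerate $\vec r\in\vec S$, $\vec S_{\ge\vec r}$ is the set of orientations of separations in $S$ having an orientation $\ge\vec r$ (for $x\ne r$ exactly one, $\vec x$); for $\vec s\ge\vec r$ in $\vec S$ define $f^{\vec r}_{\vec s}$ on $\vec S_{\ge\vec r}\setminus\{\overleftarrow r\}$ by $f(\vec x)=\vec x\vee\vec s$, $f(\overleftarrow x)=(\vec x\vee\vec s)^*$; $\vec s$ emulates $\vec r$ in $\vec S$ if the image lies in $\vec S$; then for a star $\tau\subseteq\vec S_{\ge\vec r}\setminus\{\overleftarrow r\}$ containing some $\vec x\ge\vec r$, $f^{\vec r}_{\vec s}(\tau)$ is the shift of $\tau$ from $\vec r$ to $\vec s$. $\mathcal F$ forces $\vec r$ if $\{\overleftarrow r\}\in\mathcal F$. With $\mathcal F=\mathcal P_k$: $\mathcal G_0=\mathcal F^*$, $\mathcal G_{n+1}$ = shifts of members of $\mathcal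 G_n$ from nontrivial nondegenerate $\vec r$ not forced by $\mathcal F$ to some $\vec s$ emulating $\vec r$; $\widehat{\mathcal F^*}=\bigcup_n\mathcal G_n$; $\overline{\mathcal F^*}=\widehat{\mathcal F^*}\cup\{\{\vec x\}:\vec x\in\vec S,\overleftarrow x\text{ small}\}$. An $S_k$-tree over $\mathcal H$ is a tree $T$ with a map $\alpha$ from oriented edges of $T$ to $\vec S_k$ such that $\alpha(t_2,t_1)=\alpha(t_1,t_2)^*$ and $\{\alpha(t',t):(t',t)\text{ oriented edge}\}\in\mathcal H$ for every node $t$. -}

module Defs where

open import Level using (0ℓ)
open import Data.Nat as ℕ using (ℕ; suc; _<_)
open import Data.Fin using (Fin; zero; suc; toℕ)
open import Data.Fin.Subset using (Subset; _∈_; _∉_; _∩_; _∪_; ⊤; _⊆_; ∣_∣)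
open import Data.Bool using (Bool; false)
open import Data.Product using (Σ; ∃; ∃-syntax; _×_; _,_)
open import Data.Sum using (_⊎_)
open import Data.List using (List; []; _∷_)
open import Data.List.Membership.Propositional using () renaming (_∈_ to _∈ₗ_)
open import Relation.Binary.PropositionalEquality using (_≡_; _≢_)
open import Relation.Nullary using (¬_)
open import Relation.Unary using (Pred)
open import Function.Bundles using (_⇔_)

-- Oriented separations (A , B) of a graph on vertex set Fin n.
-- Elements of U⃗ are pairs of vertex subsets; being a separation is the
-- predicate IsSep below.

OSep : ℕ → Set
OSep n = Subset n × Subset n

module _ {n : ℕ} where

  _* : OSep n → OSep n
  (A , B) * = B , A

  _≤ₛ_ : OSep n → OSep n → Set
  (A , B) ≤ₛ (C , D) = (A ⊆ C) × (D ⊆ B)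

  _<ₛ_ : OSep n → OSep n → Set
  r <ₛ s = (r ≤ₛ s) × (r ≢ s)

  _∨ₛ_ : OSep n → OSep n → OSep n
  (A , B) ∨ₛ (C , D) = (A ∪ C) , (B ∩ D)

  _∧ₛ_ : OSep n → OSep n → OSep n
  (A , B) ∧ₛ (C , D) = (A ∩ C) , (B ∪ D)

  order : OSep n → ℕ
  order (A , B) = ∣ A ∩ B ∣

  Degenerate : OSep n → Set
  Degenerate s = s * ≡ s

  Small : OSep n → Set
  Small s = s ≤ₛ (s *)

  SameSep : OSep n → OSep n → Set
  SameSep r s = (s ≡ r) ⊎ (s ≡ r *)

  -- finite sets of oriented separations are represented by lists,
  -- considered up to having the same members
  SetOS : Set
  SetOS = List (OSep n)

  _≐_ : SetOS → SetOS → Set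
  σ ≐ τ = ∀ x → (x ∈ₗ σ) ⇔ (x ∈ₗ τ)

  Fam : Set₁
  Fam = Pred SetOS 0ℓ

  _∈ᵖ_ : Pred (OSep n) 0ℓ → Fam → Set
  P ∈ᵖ H = ∃[ σ ] (H σ × (∀ x → (x ∈ₗ σ) ⇔ P x))

  _∈ᶠ_ : SetOS → Fam → Set
  τ ∈ᶠ H = (λ x → x ∈ₗ τ) ∈ᵖ H

  IsStar : SetOS → Set
  IsStar σ = (∀ x → x ∈ₗ σ → ¬ Degenerate x)
           × (∀ r s → r ∈ₗ σ → s ∈ₗ σ → r ≢ s → r ≤ₛ (s *))

-- Notions depending on the graph G = (Fin n, adj).
-- An edge between x and y exists iff adj x y ≡ true or adj y x ≡ true.

module _ {n : ℕ} (adj : Fin n → Fin n → Bool) where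

  NoEdge : Subset n → Subset n → Set
  NoEdge A B = ∀ x y → x ∈ A → x ∉ B → y ∈ B → y ∉ A → adj x y ≡ false

  IsSep : OSep n → Set
  IsSep (A , B) = (A ∪ B ≡ ⊤) × NoEdge A B × NoEdge B A

  module _ (k : ℕ) where

    InS : OSep n → Set
    InS s = IsSep s × (order s < k)

    IsP : SetOS → Set
    IsP σ = ∃[ A ] ∃[ B ] ∃[ C ] ∃[ D ]
              IsSep (A , B) × IsSep (C , D) × IsSep ((B ∩ D) , (A ∪ C))
              × (σ ≐ ((A , B) ∷ (C , D) ∷ ((B ∩ D) , (A ∪ C)) ∷ []))

    Pk : Fam
    Pk σ = IsP σ × (∀ x → x ∈ₗ σ → InS x)

    IsOrientation : Pred (OSep n) 0ℓ → Set
    IsOrientation O = (∀ x → O x → InS x)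
                    × (∀ s → InS s → O s ⊎ O (s *))
                    × (∀ s → O s → O (s *) → s ≡ s *)

    Consistent : Pred (OSep n) 0ℓ → Set
    Consistent O = ∀ r s → O (r *) → O s → ¬ SameSep r s → ¬ (r <ₛ s)

    IsProfile : Pred (OSep n) 0ℓ → Set
    IsProfile O = IsOrientation O × Consistent O
                × (∀ σ → IsP σ → ¬ (∀ x → x ∈ₗ σ → O x))

    HasProfile : Set₁
    HasProfile = ∃[ O ] IsProfile O

    -- replace distinct members x₁ , x₂ of σ by x₁ ∧ x₂* , x₂
    -- (the second variant of the paper is this one with x₁, x₂ swapped)
    UStep : SetOS → SetOS → Set
    UStep σ τ = ∃[ x₁ ] ∃[ x₂ ] (x₁ ∈ₗ σ) × (x₂ ∈ₗ σ) × (x₁ ≢ x₂)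
                × InS (x₁ ∧ₛ (x₂ *))
                × (∀ y → (y ∈ₗ τ) ⇔ (((y ∈ₗ σ) × (y ≢ x₁) × (y ≢ x₂))
                                     ⊎ (y ≡ x₁ ∧ₛ (x₂ *)) ⊎ (y ≡ x₂)))

    data Uncr : SetOS → SetOS → Set where
      done : ∀ {σ τ} → σ ≐ τ → Uncr σ τ
      step : ∀ {σ ρ τ} → UStep σ ρ → Uncr ρ τ → Uncr σ τ

    IsUncrossingOf : Fam → Fam → Set
    IsUncrossingOf F Fstar =
        (∀ τ → Fstar τ → IsStar τ × (∃[ σ ] F σ × Uncr σ τ))
      × (∀ σ → F σ → ∃[ τ ] Fstar τ × Uncr σ τ)

    Trivial : OSep n → Set
    Trivial r = ∃[ s ] InS s × (r <ₛ s) × (r <ₛ (s *))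

    GeqDom : OSep n → OSep n → Set
    GeqDom r y = InS y × ((r ≤ₛ y) ⊎ (r ≤ₛ (y *))) × (y ≢ r *)

    -- the graph of f^r_s : f(x) = x ∨ s if x ≥ r, f(x*) = (x ∨ s)*
    ShiftMap : OSep n → OSep n → OSep n → OSep n → Set
    ShiftMap r s y z = ((r ≤ₛ y) × (z ≡ y ∨ₛ s))
                     ⊎ ((¬ (r ≤ₛ y)) × (z ≡ ((y *) ∨ₛ s) *))

    Emulates : OSep n → OSep n → Set
    Emulates s r = InS s × (r ≤ₛ s)
                 × (∀ y z → GeqDom r y → ShiftMap r s y z → InS z)

    Forces : Fam → OSep n → Set
    Forces F r = ((r *) ∷ []) ∈ᶠ F

    IsShift : OSep n → OSep n → SetOS → SetOS → Set
    IsShift r s τ τ' = IsStar τ × (∀ y → y ∈ₗ τ → GeqDom r y)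
                     × (∃[ x ] (x ∈ₗ τ) × (r ≤ₛ x))
                     × (∀ z → (z ∈ₗ τ') ⇔ (∃[ y ] (y ∈ₗ τ) × ShiftMap r s y z))

    -- \widehat{𝓕*} = ⋃ 𝓖_n  with 𝓕 = 𝒫_k
    data Hat (Fstar : Fam) : Fam where
      base  : ∀ {τ} → Fstar τ → Hat Fstar τ
      shift : ∀ {r s τ τ'} → Hat Fstar τ
            → InS r → ¬ Trivial r → ¬ Degenerate r → ¬ Forces Pk r
            → Emulates s r → IsShift r s τ τ' → Hat Fstar τ'

    Bar : Fam → Fam
    Bar Fstar τ = Hat Fstar τ ⊎ (∃[ x ] InS x × Small (x *) × (τ ≡ x ∷ []))

    -- S_k-trees over H.
    -- A finite tree on nodes Fin (suc m): node (suc i) has parent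
    -- (parent i) of smaller index; every finite tree arises this way.
    -- β i = α(suc i , parent i) (edge oriented towards the parent);
    -- then α(parent i , suc i) = (β i)*.
    record SkTree (H : Fam) : Set where
      field
        m       : ℕ
        parent  : Fin m → Fin (suc m)
        parent< : ∀ i → toℕ (parent i) ℕ.≤ toℕ i
        β       : Fin m → OSep n
        β∈S     : ∀ i → InS (β i)
        -- {α(t',t) : (t',t) oriented edge} ∈ H for every node t
        nodes   : ∀ (t : Fin (suc m)) →
                    (λ x → (∃[ i ] (parent i ≡ t) × (x ≡ β i))
                         ⊎ (∃[ j ] (t ≡ suc j) × (x ≡ (β j) *))) ∈ᵖ H

{-# OPTIONS --safe #-}
module Submission where

-- A profile orients the edges of a tree and so contains the set of labels at some sink.
-- It contains no (V , A), hence no singleton at a leaf, and an element of Hat inside it could be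
-- unshifted and uncrossed into an element of P_k inside it.
--
-- Conversely, let A ⊆ S be closed downwards and contain the small separations. By induction on the
-- number of separations outside A we find either a profile containing A or a tree over Hat whose
-- remaining leaves are {a *}, a ∈ A. If A orients all of S, it is a profile, or it contains a
-- separation with its inverse or a triple, whose uncrossings then lie in A as well. Otherwise pick s
-- with neither orientation in A, and r ≤ s, t ≤ s * minimal outside A. The trees for A ∪ {r} and
-- A ∪ {t} use the leaves r and t at most once each; they are shifted to a separation of minimum order
-- between r and t *, which emulates both by submodularity, and are joined there.

open import Defs
open import Level using (0ℓ)
open import Data.Bool as Bool using (Bool; true; false; _∧_; _∨_)
open import Data.Empty using (⊥)
open import Data.Fin using (Fin; zero; suc; toℕ; _↑ˡ_; _↑ʳ_; splitAt; join)
open import Data.Fin.Properties as Fin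
  using (all?; any?; splitAt-join; join-splitAt; toℕ-↑ˡ; toℕ-↑ʳ; ↑ˡ-injective; ↑ʳ-injective)
open import Data.Fin.Subset using (Subset; _∈_; _∉_; _∩_; _∪_; ⊤; _⊆_; ∣_∣; ⁅_⁆; _-_; ∁; inside; outside)
open import Data.Fin.Subset.Properties hiding (_∈?_)
open import Data.Fin.Subset.Properties using () renaming (_∈?_ to _∈ˢ?_)
open import Data.List using (List; []; _∷_; _++_; map; filter; length; cartesianProduct)
open import Data.List.Membership.Propositional using (find; lose) renaming (_∈_ to _∈ₗ_)
open import Data.List.Membership.Propositional.Properties
open import Data.List.Relation.Unary.Any as Any using (here; there)
open import Data.Nat as ℕ using (ℕ; zero; suc; _+_; _<_; _≤_; z≤n; s≤s)
open import Data.Nat.Properties as ℕ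
open import Data.Nat.Induction using (<-wellFounded)
open import Algebra.Properties.CommutativeSemigroup ℕ.+-commutativeSemigroup using (interchange)
open import Data.Product using (∃; ∃-syntax; _×_; _,_; proj₁; proj₂; swap)
open import Data.Product.Properties using () renaming (≡-dec to ×-≡-dec)
open import Data.Sum using (_⊎_; inj₁; inj₂; [_,_]′; map₂)
open import Data.Sum.Function.Propositional using (_⊎-⇔_)
open import Data.Vec using ([]; _∷_)
open import Data.Vec.Properties using () renaming (≡-dec to Vec-≡-dec)
open import Function using (_∘_; flip)
open import Function.Bundles using (_⇔_; mk⇔; Equivalence)
open import Function.Construct.Composition using (_⇔-∘_)
open import Function.Construct.Identity using (⇔-id)
open import Function.Construct.Symmetry using (⇔-sym)
open import Induction.WellFounded using (Acc; acc)
open import Relation.Binary.Definitions using (DecidableEquality)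
open import Relation.Binary.PropositionalEquality
open import Relation.Nullary using (¬_; Dec; yes; no; contradiction)
open import Relation.Nullary.Decidable using (map′; decidable-stable; _×-dec_; _⊎-dec_; _→-dec_; ¬?)
open import Relation.Unary using (Pred; Decidable)

open Equivalence using (to; from)

-- The lattice of oriented separations, and submodularity of the order.

module _ {n : ℕ} where

  ≤ₛ-refl : ∀ (x : OSep n) → x ≤ₛ x
  ≤ₛ-refl x = (λ p → p) , (λ p → p)

  ≤ₛ-trans : ∀ (x y z : OSep n) → x ≤ₛ y → y ≤ₛ z → x ≤ₛ z
  ≤ₛ-trans x y z (p , q) (p′ , q′) = (λ v → p′ (p v)) , (λ v → q (q′ v))

  ≤ₛ-antisym : ∀ (x y : OSep n) → x ≤ₛ y → y ≤ₛ x → x ≡ y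
  ≤ₛ-antisym x y (p , q) (p′ , q′) = cong₂ _,_ (⊆-antisym p p′) (⊆-antisym q′ q)

  x≤x∨y : ∀ (x y : OSep n) → x ≤ₛ (x ∨ₛ y)
  x≤x∨y (A , B) (C , D) = p⊆p∪q C , p∩q⊆p B D

  y≤x∨y : ∀ (x y : OSep n) → y ≤ₛ (x ∨ₛ y)
  y≤x∨y (A , B) (C , D) = q⊆p∪q A C , p∩q⊆q B D

  x∧y≤x : ∀ (x y : OSep n) → (x ∧ₛ y) ≤ₛ x
  x∧y≤x x y = swap (x≤x∨y (x *) (y *))

  x∧y≤y : ∀ (x y : OSep n) → (x ∧ₛ y) ≤ₛ y
  x∧y≤y x y = swap (y≤x∨y (x *) (y *))

  ∨-least : ∀ (x y z : OSep n) → x ≤ₛ z → y ≤ₛ z → (x ∨ₛ y) ≤ₛ z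
  ∨-least (A , B) (C , D) z (p , q) (p′ , q′) =
    (λ v → [ p , p′ ]′ (x∈p∪q⁻ A C v)) , (λ v → x∈p∩q⁺ (q v , q′ v))

  ∧-greatest : ∀ (x y z : OSep n) → z ≤ₛ x → z ≤ₛ y → z ≤ₛ (x ∧ₛ y)
  ∧-greatest x y z p q = swap (∨-least (x *) (y *) (z *) (swap p) (swap q))

  _≤ₛ?_ : ∀ (x y : OSep n) → Dec (x ≤ₛ y)
  (A , B) ≤ₛ? (C , D) = (A ⊆? C) ×-dec (D ⊆? B)

  _≟ₛ_ : DecidableEquality (OSep n)
  _≟ₛ_ = ×-≡-dec (Vec-≡-dec Bool._≟_) (Vec-≡-dec Bool._≟_)

  ∨-monoˡ : ∀ (x y z : OSep n) → x ≤ₛ y → (x ∨ₛ z) ≤ₛ (y ∨ₛ z)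
  ∨-monoˡ x y z x≤y = ∨-least x z (y ∨ₛ z) (≤ₛ-trans x y (y ∨ₛ z) x≤y (x≤x∨y y z)) (y≤x∨y y z)

  small-down : ∀ (x y : OSep n) → x ≤ₛ y → Small y → Small x
  small-down x y p q = ≤ₛ-trans x y (x *) p (≤ₛ-trans y (y *) (x *) q (swap p))

  -- Mostly used in contrapositive form: a separation that is not small lies below at most one
  -- orientation of any separation.
  between-small : ∀ (x y : OSep n) → x ≤ₛ y → x ≤ₛ (y *) → Small x
  between-small x y p q = ≤ₛ-trans x y (x *) p (swap q)

  degenerate⇒small : ∀ (x : OSep n) → Degenerate x → Small x
  degenerate⇒small x eq = subst (x ≤ₛ_) (sym eq) (≤ₛ-refl x)

  anyOSep? : ∀ {P : Pred (OSep n) 0ℓ} → Decidable P → Dec (∃ P)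
  anyOSep? P? = map′ (λ (A , B , p) → (A , B) , p) (λ ((A , B) , p) → A , B , p)
                  (anySubset? λ A → anySubset? λ B → P? (A , B))

  minimal : ∀ {P : Pred (OSep n) 0ℓ} → Decidable P → (f : OSep n → ℕ) → ∃ P →
            ∃[ x ] (P x × (∀ y → P y → f x ≤ f y))
  minimal {P} P? f (x , px) = go x px (<-wellFounded (f x))
    where
    go : ∀ x → P x → Acc _<_ (f x) → ∃[ x ] (P x × (∀ y → P y → f x ≤ f y))
    go x px (acc rs) with anyOSep? (λ y → P? y ×-dec (f y ℕ.<? f x))
    ... | yes (y , py , y<x) = go y py (rs y<x)
    ... | no  none           = x , px , λ y py → ≮⇒≥ (λ y<x → none (y , py , y<x))

  -- Taking the complement of the second side makes both summands grow along `≤ₛ`, so an element of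
  -- least height is minimal in that order.
  height : OSep n → ℕ
  height (A , B) = ∣ A ∣ + ∣ ∁ B ∣

  ⊆∧⊉⇒∣∣< : ∀ (p q : Subset n) → p ⊆ q → ¬ (q ⊆ p) → ∣ p ∣ < ∣ q ∣
  ⊆∧⊉⇒∣∣< p q p⊆q q⊈p with any? (λ v → (v ∈ˢ? q) ×-dec ¬? (v ∈ˢ? p))
  ... | yes w = p⊂q⇒∣p∣<∣q∣ (p⊆q , w)
  ... | no ¬w = contradiction (λ {v} v∈q → decidable-stable (v ∈ˢ? p) λ v∉p → ¬w (v , v∈q , v∉p)) q⊈p

  ≤ₛ∧height≥⇒≡ : ∀ (x y : OSep n) → x ≤ₛ y → height y ≤ height x → x ≡ y
  ≤ₛ∧height≥⇒≡ (A , B) (C , D) (A⊆C , D⊆B) h with C ⊆? A | B ⊆? D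
  ... | yes C⊆A | yes B⊆D = ≤ₛ-antisym _ _ (A⊆C , D⊆B) (C⊆A , B⊆D)
  ... | no  C⊈A | _       = contradiction h (<⇒≱
    (+-mono-<-≤ (⊆∧⊉⇒∣∣< A C A⊆C C⊈A) (p⊆q⇒∣p∣≤∣q∣ (p⊆q⇒∁p⊇∁q D⊆B))))
  ... | yes _   | no B⊈D  = contradiction h (<⇒≱
    (+-mono-≤-< (p⊆q⇒∣p∣≤∣q∣ A⊆C) (⊆∧⊉⇒∣∣< (∁ B) (∁ D) (p⊆q⇒∁p⊇∁q D⊆B) (λ ∁D⊆∁B → B⊈D (∁p⊆∁q⇒p⊇q ∁D⊆∁B)))))

  ∨-idem : ∀ (x : OSep n) → x ∨ₛ x ≡ x
  ∨-idem (A , B) = cong₂ _,_ (∪-idem A) (∩-idem B)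

-- Both sides are sums over the vertices, so it suffices to compare them at a single vertex. The
-- pairs need not cover the vertex set: a vertex of A ∩ B in neither C nor D makes the inequality
-- strict.
∣∣-submodular : ∀ {n} (A B C D : Subset n) →
  ∣ (A ∩ C) ∩ (B ∪ D) ∣ + ∣ (A ∪ C) ∩ (B ∩ D) ∣ ≤ ∣ A ∩ B ∣ + ∣ C ∩ D ∣
∣∣-submodular [] [] [] [] = z≤n
∣∣-submodular (a ∷ A) (b ∷ B) (c ∷ C) (d ∷ D) =
  subst₂ _≤_ (sum-∷ ((a ∧ c) ∧ (b ∨ d)) ((A ∩ C) ∩ (B ∪ D)) ((a ∨ c) ∧ (b ∧ d)) ((A ∪ C) ∩ (B ∩ D)))
             (sum-∷ (a ∧ b) (A ∩ B) (c ∧ d) (C ∩ D))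
             (+-mono-≤ (pointwise a b c d) (∣∣-submodular A B C D))
  where
  # : Bool → ℕ
  # true  = 1
  # false = 0

  ∣∷∣ : ∀ {m} x (p : Subset m) → ∣ x ∷ p ∣ ≡ # x + ∣ p ∣
  ∣∷∣ true  p = refl
  ∣∷∣ false p = refl

  sum-∷ : ∀ {m} x (p : Subset m) y (q : Subset m) →
          (# x + # y) + (∣ p ∣ + ∣ q ∣) ≡ ∣ x ∷ p ∣ + ∣ y ∷ q ∣
  sum-∷ x p y q = trans (interchange (# x) (# y) ∣ p ∣ ∣ q ∣)
                        (sym (cong₂ _+_ (∣∷∣ x p) (∣∷∣ y q)))

  pointwise : ∀ a b c d → # ((a ∧ c) ∧ (b ∨ d)) + # ((a ∨ c) ∧ (b ∧ d)) ≤ # (a ∧ b) + # (c ∧ d)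
  pointwise false b     false d     = z≤n
  pointwise false b     true  true  = #≤1 b
    where
    #≤1 : ∀ b → # (b ∧ true) ≤ 1
    #≤1 true  = ≤-refl
    #≤1 false = z≤n
  pointwise false true  true  false = z≤n
  pointwise false false true  false = z≤n
  pointwise true  true  false true  = ≤-refl
  pointwise true  true  false false = z≤n
  pointwise true  false false d     = z≤n
  pointwise true  true  true  true  = ≤-refl
  pointwise true  true  true  false = ≤-refl
  pointwise true  false true  true  = ≤-refl
  pointwise true  false true  false = ≤-refl

order-submodular : ∀ {n} (x y : OSep n) → order (x ∧ₛ y) + order (x ∨ₛ y) ≤ order x + order y
order-submodular (A , B) (C , D) = ∣∣-submodular A B C D

-- Enumeration and counting.

subsets : ∀ n → List (Subset n)
subsets zero    = [] ∷ []
subsets (suc n) = map (inside ∷_) (subsets n) ++ map (outside ∷_) (subsets n)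

∈-subsets : ∀ {n} (p : Subset n) → p ∈ₗ subsets n
∈-subsets []            = here refl
∈-subsets (inside ∷ p)  = ∈-++⁺ˡ (∈-map⁺ _ (∈-subsets p))
∈-subsets (outside ∷ p) = ∈-++⁺ʳ _ (∈-map⁺ _ (∈-subsets p))

osep-list : ∀ n → List (OSep n)
osep-list n = cartesianProduct (subsets n) (subsets n)

∈-osep-list : ∀ {n} (x : OSep n) → x ∈ₗ osep-list n
∈-osep-list (A , B) = ∈-cartesianProduct⁺ (∈-subsets A) (∈-subsets B)

module _ {A : Set} {P Q : Pred A 0ℓ} (P? : Decidable P) (Q? : Decidable Q) (P⇒Q : ∀ x → P x → Q x) where

  length-filter-mono : ∀ xs → length (filter P? xs) ≤ length (filter Q? xs)
  length-filter-mono [] = z≤n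
  length-filter-mono (x ∷ xs) with P? x | Q? x
  ... | yes p | yes q = s≤s (length-filter-mono xs)
  ... | yes p | no ¬q = contradiction (P⇒Q x p) ¬q
  ... | no ¬p | yes q = m≤n⇒m≤1+n (length-filter-mono xs)
  ... | no ¬p | no ¬q = length-filter-mono xs

  length-filter-< : ∀ {x xs} → x ∈ₗ xs → ¬ P x → Q x → length (filter P? xs) < length (filter Q? xs)
  length-filter-< {xs = y ∷ ys} (here refl) ¬p q with P? y | Q? y
  ... | yes p | _     = contradiction p ¬p
  ... | no _  | yes _ = s≤s (length-filter-mono ys)
  ... | no _  | no ¬q = contradiction q ¬q
  length-filter-< {xs = y ∷ ys} (there x∈) ¬p q with P? y | Q? y
  ... | yes py | yes qy = s≤s (length-filter-< x∈ ¬p q)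
  ... | yes py | no ¬qy = contradiction (P⇒Q y py) ¬qy
  ... | no ¬py | yes qy = m≤n⇒m≤1+n (length-filter-< x∈ ¬p q)
  ... | no ¬py | no ¬qy = length-filter-< x∈ ¬p q

-- This finds a sink in a tree with oriented edges. With every edge indexed by its child node, the
-- child end of the last edge pointing away from the root is a sink, since the edges to its own
-- children come later. If there is no such edge, the root is a sink.
last-or-none : ∀ {m} {P Q : Pred (Fin m) 0ℓ} → (∀ i → P i ⊎ Q i) →
               (∀ i → P i) ⊎ (∃[ j ] (Q j × (∀ i → toℕ j < toℕ i → P i)))
last-or-none {zero} h = inj₁ λ ()
last-or-none {suc m} h with last-or-none (h ∘ suc) | h zero
... | inj₂ (j , qj , after) | _      = inj₂ (suc j , qj , λ { (suc i) (s≤s j<i) → after i j<i })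
... | inj₁ all              | inj₂ q = inj₂ (zero , q , λ { (suc i) _ → all i })
... | inj₁ all              | inj₁ p = inj₁ λ { zero → p ; (suc i) → all i }

-- Closure of the separations of a graph under inverse, meet and join.

∪≡⊤⇒∈ : ∀ {n} {v : Fin n} (p q : Subset n) → p ∪ q ≡ ⊤ → v ∉ p → v ∈ q
∪≡⊤⇒∈ {v = v} p q eq v∉p = [ flip contradiction v∉p , (λ v∈q → v∈q) ]′ (x∈p∪q⁻ p q (subst (v ∈_) (sym eq) ∈⊤))

-- The far end y misses A or C, and the edge would then violate the separation whose first side it
-- misses.
noEdge-∧ : ∀ {n} (adj : Fin n → Fin n → Bool) A B C D → A ∪ B ≡ ⊤ → C ∪ D ≡ ⊤ →
           NoEdge adj A B → NoEdge adj C D → NoEdge adj (A ∩ C) (B ∪ D)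
noEdge-∧ adj A B C D AB CD ab cd x y x∈ x∉ y∈ y∉ with y ∈ˢ? A | y ∈ˢ? C
... | yes y∈A | yes y∈C = contradiction (x∈p∩q⁺ (y∈A , y∈C)) y∉
... | no y∉A  | _       = ab x y (p∩q⊆p A C x∈) (x∉ ∘ p⊆p∪q D) (∪≡⊤⇒∈ A B AB y∉A) y∉A
... | yes _   | no y∉C  = cd x y (p∩q⊆q A C x∈) (x∉ ∘ q⊆p∪q B D) (∪≡⊤⇒∈ C D CD y∉C) y∉C

noEdge-flip : ∀ {n} (adj : Fin n → Fin n → Bool) A B → NoEdge adj A B → NoEdge (flip adj) B A
noEdge-flip adj A B h x y x∈ x∉ y∈ y∉ = h y x y∈ y∉ x∈ x∉

module _ {n : ℕ} (adj : Fin n → Fin n → Bool) where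

  isSep-* : ∀ x → IsSep adj x → IsSep adj (x *)
  isSep-* (A , B) (AB , ab , ba) = trans (∪-comm B A) AB , ba , ab

  isSep-∧ : ∀ x y → IsSep adj x → IsSep adj y → IsSep adj (x ∧ₛ y)
  isSep-∧ (A , B) (C , D) (AB , ab , ba) (CD , cd , dc) =
    ⊆-antisym (⊆-max _) (λ {v} _ → cover v) ,
    noEdge-∧ adj A B C D AB CD ab cd ,
    -- `adj` may be asymmetric, so the opposite direction is the same lemma for the flipped
    -- relation.
    noEdge-flip (flip adj) (A ∩ C) (B ∪ D)
      (noEdge-∧ (flip adj) A B C D AB CD (noEdge-flip adj B A ba) (noEdge-flip adj D C dc))
    where
    cover : ∀ v → v ∈ (A ∩ C) ∪ (B ∪ D)
    cover v with v ∈ˢ? A | v ∈ˢ? C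
    ... | yes v∈A | yes v∈C = x∈p∪q⁺ (inj₁ (x∈p∩q⁺ (v∈A , v∈C)))
    ... | no v∉A  | _       = x∈p∪q⁺ (inj₂ (x∈p∪q⁺ (inj₁ (∪≡⊤⇒∈ A B AB v∉A))))
    ... | yes _   | no v∉C  = x∈p∪q⁺ (inj₂ (x∈p∪q⁺ (inj₂ (∪≡⊤⇒∈ C D CD v∉C))))

  isSep-∨ : ∀ x y → IsSep adj x → IsSep adj y → IsSep adj (x ∨ₛ y)
  isSep-∨ x y hx hy = isSep-* ((x *) ∧ₛ (y *)) (isSep-∧ (x *) (y *) (isSep-* x hx) (isSep-* y hy))

  isSep-⊤ : ∀ A → IsSep adj (A , ⊤)
  isSep-⊤ A = ⊆-antisym (⊆-max _) (q⊆p∪q A ⊤) ,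
    (λ _ _ _ x∉ _ _ → contradiction ∈⊤ x∉) , (λ _ _ _ _ _ y∉ → contradiction ∈⊤ y∉)

  noEdge? : ∀ A B → Dec (NoEdge adj A B)
  noEdge? A B = all? λ x → all? λ y → (x ∈ˢ? A) →-dec (¬? (x ∈ˢ? B) →-dec
    ((y ∈ˢ? B) →-dec (¬? (y ∈ˢ? A) →-dec (adj x y Bool.≟ false))))

  isSep? : Decidable (IsSep adj)
  isSep? (A , B) = Vec-≡-dec Bool._≟_ (A ∪ B) ⊤ ×-dec (noEdge? A B ×-dec noEdge? B A)

  order-* : ∀ (x : OSep n) → order (x *) ≡ order x
  order-* (A , B) = cong ∣_∣ (∩-comm B A)

  -- Separations of order below `k`, triples and uncrossing.

  module _ (k : ℕ) where

    inS? : Decidable (InS adj k)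
    inS? x = isSep? x ×-dec (order x ℕ.<? k)

    inS-* : ∀ x → InS adj k x → InS adj k (x *)
    inS-* x (sx , ox) = isSep-* x sx , subst (_< k) (sym (order-* x)) ox

    -- A degenerate separation is (V , V), whose order is `n`.
    inS⇒nondegenerate : k ≤ n → ∀ x → InS adj k x → ¬ Degenerate x
    inS⇒nondegenerate k≤n (A , B) ((AB , _) , o) refl =
      <⇒≱ o (subst (λ p → k ≤ ∣ p ∣) (sym A∩A≡⊤) (subst (k ≤_) (sym (∣⊤∣≡n n)) k≤n))
      where
      A∩A≡⊤ : A ∩ A ≡ ⊤
      A∩A≡⊤ = trans (∩-idem A) (trans (sym (∪-idem A)) AB)

    trivial⇒small : ∀ x → Trivial adj k x → Small x
    trivial⇒small x (s , _ , (x≤s , _) , (x≤s* , _)) = between-small x s x≤s x≤s*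

    isP⇒triple : ∀ {σ} → IsP adj k σ → ∃[ x ] ∃[ y ] (x ∈ₗ σ × y ∈ₗ σ × (((x ∨ₛ y) *) ∈ₗ σ))
    isP⇒triple (A , B , C , D , _ , _ , _ , eq) =
      (A , B) , (C , D) , from (eq _) (here refl) , from (eq _) (there (here refl)) ,
      from (eq _) (there (there (here refl)))

    triple : OSep n → OSep n → SetOS
    triple x y = x ∷ y ∷ ((x ∨ₛ y) *) ∷ []

    triple-all : ∀ {Q : Pred (OSep n) 0ℓ} x y → Q x → Q y → Q ((x ∨ₛ y) *) → ∀ z → z ∈ₗ triple x y → Q z
    triple-all x y qx qy qxy _ (here refl)                 = qx
    triple-all x y qx qy qxy _ (there (here refl))         = qy
    triple-all x y qx qy qxy _ (there (there (here refl))) = qxy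

    triple-isP : ∀ x y → IsSep adj x → IsSep adj y → IsP adj k (triple x y)
    triple-isP x y sx sy = _ , _ , _ , _ , sx , sy , isSep-* (x ∨ₛ y) (isSep-∨ x y sx sy) ,
      λ _ → mk⇔ (λ z → z) (λ z → z)

    -- In a triple with a single member y, the third entry is the inverse of y ∨ y = y. Hence the
    -- condition of `shift` that r is not forced holds whenever r is not small.
    forced⇒degenerate : ∀ x → Forces adj k (Pk adj k) x → Degenerate x
    forced⇒degenerate x (σ , (σP , _) , eq) with isP⇒triple σP
    ... | y , z , y∈ , z∈ , w∈ with to (eq y) y∈ | to (eq z) z∈ | to (eq _) w∈
    ... | here refl | here refl | here w = sym (trans (sym (cong _* (∨-idem (x *)))) w)

    uncr-invariant : ∀ {σ τ} (Q : Pred (OSep n) 0ℓ) →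
      (∀ x y → Q x → Q y → InS adj k (x ∧ₛ (y *)) → Q (x ∧ₛ (y *))) →
      Uncr adj k σ τ → (∀ x → x ∈ₗ σ → Q x) → ∀ x → x ∈ₗ τ → Q x
    uncr-invariant Q Q∧ (done eq) Qσ x x∈ = Qσ x (from (eq x) x∈)
    uncr-invariant {σ} Q Q∧ (step {ρ = ρ} (x₁ , x₂ , x₁∈ , x₂∈ , _ , inS , eq) u) Qσ =
      uncr-invariant Q Q∧ u Qρ
      where
      Qρ : ∀ x → x ∈ₗ ρ → Q x
      Qρ x x∈ with to (eq x) x∈
      ... | inj₁ (x∈σ , _)    = Qσ x x∈σ
      ... | inj₂ (inj₁ refl) = Q∧ x₁ x₂ (Qσ x₁ x₁∈) (Qσ x₂ x₂∈) inS
      ... | inj₂ (inj₂ refl) = Qσ x₂ x₂∈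

    uncr-nonempty : ∀ {σ τ} → Uncr adj k σ τ → ∃[ x ] (x ∈ₗ σ) → ∃[ x ] (x ∈ₗ τ)
    uncr-nonempty (done eq) (x , x∈) = x , to (eq x) x∈
    uncr-nonempty (step (_ , x₂ , _ , _ , _ , _ , eq) u) _ =
      uncr-nonempty u (x₂ , from (eq x₂) (inj₂ (inj₂ refl)))

    -- Properties of a profile.

    module _ (2<k : 2 < k) (O : Pred (OSep n) 0ℓ) (profile : IsProfile adj k O) where

      O⊆S : ∀ x → O x → InS adj k x
      O⊆S = proj₁ (proj₁ profile)

      O-total : ∀ x → InS adj k x → O x ⊎ O (x *)
      O-total = proj₁ (proj₂ (proj₁ profile))

      consistent : Consistent adj k O
      consistent = proj₁ (proj₂ profile)

      no-triple : ∀ x y → O x → O y → ¬ O ((x ∨ₛ y) *)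
      no-triple x y Ox Oy Oxy = proj₂ (proj₂ profile) (triple x y)
        (triple-isP x y (proj₁ (O⊆S x Ox)) (proj₁ (O⊆S y Oy)))
        (triple-all x y Ox Oy Oxy)

      ∣∣<k⇒inS : ∀ A → ∣ A ∣ < k → InS adj k (A , ⊤)
      ∣∣<k⇒inS A A<k = isSep-⊤ A , ≤-<-trans (∣p∩q∣≤∣p∣ A ⊤) A<k

      -- If |A| + 1 < k then (A , V) is trivial, witnessed by (A ∪ {v} , V) with v ∉ A.
      ∣∣+1<k⇒⊤∉O : ∀ A → suc ∣ A ∣ < k → ¬ O (⊤ , A)
      ∣∣+1<k⇒⊤∉O A A<k O⊤A with any? (λ v → ¬? (v ∈ˢ? A))
      -- If A = V, the separation is degenerate, and taken twice it forms a forbidden triple on its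
      -- own.
      ... | no ¬w = no-triple (⊤ , A) (⊤ , A) O⊤A O⊤A (subst O degenerate O⊤A)
        where
        A≡⊤ : A ≡ ⊤
        A≡⊤ = ⊆-antisym (⊆-max A) λ {v} _ → decidable-stable (v ∈ˢ? A) λ v∉A → ¬w (v , v∉A)

        degenerate : (⊤ , A) ≡ ((⊤ , A) ∨ₛ (⊤ , A)) *
        degenerate = trans (cong₂ _,_ (sym A≡⊤) A≡⊤) (sym (cong _* (∨-idem (⊤ , A))))
      ... | yes (v , v∉A) = [ (λ Or → consistent a r O⊤A Or a≁r (a≤r , a≢r)) ,
                              (λ Or* → consistent a (r *) O⊤A Or* a≁r* (a≤r* , a≢r*)) ]′
                            (O-total r r∈S)
        where
        a r : OSep n
        a = A , ⊤
        r = a ∨ₛ (⁅ v ⁆ , ⊤)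

        r∈S : InS adj k r
        r∈S = isSep-∨ a (⁅ v ⁆ , ⊤) (isSep-⊤ A) (isSep-⊤ ⁅ v ⁆) , (begin-strict
          order r                                   ≤⟨ m≤n+m (order r) (order (a ∧ₛ (⁅ v ⁆ , ⊤))) ⟩
          order (a ∧ₛ (⁅ v ⁆ , ⊤)) + order r        ≤⟨ order-submodular a (⁅ v ⁆ , ⊤) ⟩
          order a + order (⁅ v ⁆ , ⊤)               ≤⟨ +-mono-≤ (∣p∩q∣≤∣p∣ A ⊤) (∣p∩q∣≤∣p∣ ⁅ v ⁆ ⊤) ⟩
          ∣ A ∣ + ∣ ⁅ v ⁆ ∣                         ≡⟨ cong (∣ A ∣ +_) (∣⁅x⁆∣≡1 v) ⟩
          ∣ A ∣ + 1                                 ≡⟨ ℕ.+-comm ∣ A ∣ 1 ⟩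
          suc ∣ A ∣                                 <⟨ A<k ⟩
          k                                         ∎)
          where open ≤-Reasoning

        v∈r : v ∈ A ∪ ⁅ v ⁆
        v∈r = q⊆p∪q A ⁅ v ⁆ (x∈⁅x⁆ v)

        v∈⊤∩⊤ : v ∈ ⊤ ∩ ⊤
        v∈⊤∩⊤ = x∈p∩q⁺ (∈⊤ , ∈⊤)

        a≤r : a ≤ₛ r
        a≤r = x≤x∨y a (⁅ v ⁆ , ⊤)

        a≤r* : a ≤ₛ (r *)
        a≤r* = (λ _ → x∈p∩q⁺ (∈⊤ , ∈⊤)) , ⊆-max _

        a≢r : a ≢ r
        a≢r eq = v∉A (subst (v ∈_) (sym (cong proj₁ eq)) v∈r)

        a≢r* : a ≢ r *
        a≢r* eq = v∉A (subst (v ∈_) (sym (cong proj₁ eq)) v∈⊤∩⊤)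

        a≁r : ¬ SameSep a r
        a≁r (inj₁ eq) = a≢r (sym eq)
        a≁r (inj₂ eq) = a≢r* (sym (cong _* eq))

        a≁r* : ¬ SameSep a (r *)
        a≁r* (inj₁ eq) = a≢r* (sym eq)
        a≁r* (inj₂ eq) = a≢r (sym (cong _* eq))

      -- The profile property applied to (A ∖ {v} , V) and ({v} , V) reduces to smaller A.
      ⊤∉O : ∀ A → ∣ A ∣ < k → ¬ O (⊤ , A)
      ⊤∉O A A<k O⊤A with nonempty? A
      ... | no  empty = ∣∣+1<k⇒⊤∉O A
        (subst (λ m → suc m < k) (sym (trans (cong ∣_∣ (Empty-unique empty)) (∣⊥∣≡0 n))) (<⇒≤ 2<k)) O⊤A
      ... | yes (v , v∈A) = no-triple (A - v , ⊤) (⁅ v ⁆ , ⊤)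
        (oriented (A - v) (≤-<-trans (x∈p⇒∣p-x∣<∣p∣ v∈A) A<k))
        -- This is where `2 < k` enters in full: `oriented` requires |B| + 1 < k, and the singleton
        -- has size one.
        (oriented ⁅ v ⁆ (subst (λ m → suc m < k) (sym (∣⁅x⁆∣≡1 v)) 2<k))
        (subst O (cong₂ _,_ (sym (∩-idem ⊤)) (⊆-antisym A⊆ ⊆A)) O⊤A)
        where
        oriented : ∀ B → suc ∣ B ∣ < k → O (B , ⊤)
        oriented B B<k = [ (λ z → z) , flip contradiction (∣∣+1<k⇒⊤∉O B B<k) ]′
          (O-total (B , ⊤) (∣∣<k⇒inS B (<⇒≤ B<k)))

        A⊆ : A ⊆ (A - v) ∪ ⁅ v ⁆
        A⊆ {w} w∈A with w Fin.≟ v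
        ... | yes refl = q⊆p∪q (A - v) ⁅ v ⁆ (x∈⁅x⁆ v)
        ... | no w≢v   = p⊆p∪q ⁅ v ⁆ (x∈p∧x≢y⇒x∈p-y w∈A w≢v)

        ⊆A : (A - v) ∪ ⁅ v ⁆ ⊆ A
        ⊆A w∈ with x∈p∪q⁻ (A - v) ⁅ v ⁆ w∈
        ... | inj₁ w∈A-v = p─q⊆p A ⁅ v ⁆ w∈A-v
        ... | inj₂ w∈v   = subst (_∈ A) (sym (x∈⁅y⁆⇒x≡y v w∈v)) v∈A

      -- A small separation has its first side inside the second, and the two cover V, so it has the
      -- form (A , V).
      small*∉O : ∀ x → Small (x *) → ¬ O x
      small*∉O (B , A) (A⊆B , _) OBA with B≡⊤
        where
        B≡⊤ : B ≡ ⊤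
        B≡⊤ = ⊆-antisym (⊆-max B) λ {v} _ →
          [ (λ v∈B → v∈B) , A⊆B ]′ (x∈p∪q⁻ B A (subst (v ∈_) (sym (proj₁ (proj₁ (O⊆S _ OBA)))) ∈⊤))
      ... | refl = ⊤∉O A (subst (λ p → ∣ p ∣ < k) (∩-identityˡ A) (proj₂ (O⊆S _ OBA))) OBA

      -- Consistency settles the case of two different separations. If x is the inverse of y, then x
      -- ≤ y says that x is small, and the inverse of a small separation is never in `O`.
      O-down : ∀ x y → InS adj k x → x ≤ₛ y → O y → O x
      O-down x y x∈S x≤y Oy with O-total x x∈S | x ≟ₛ y | x ≟ₛ (y *)
      ... | inj₁ Ox  | _        | _        = Ox
      ... | inj₂ Ox* | yes refl | _        = Oy
      ... | inj₂ Ox* | no _     | yes refl = contradiction Oy (small*∉O y x≤y)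
      ... | inj₂ Ox* | no x≢y   | no x≢y*  = contradiction (x≤y , x≢y)
        (consistent x y Ox* Oy [ (λ eq → x≢y (sym eq)) , (λ eq → x≢y* (cong _* (sym eq))) ]′)

      -- Since x ∧ y * is the inverse of x * ∨ y, it would form a forbidden triple with x * and y.
      -- This undoes both an uncrossing step and the shift of a member not above r.
      O-∧ : ∀ x y → InS adj k x → O y → O (x ∧ₛ (y *)) → O x
      O-∧ x y x∈S Oy Oxy = [ (λ z → z) , (λ Ox* → contradiction Oxy (no-triple (x *) y Ox* Oy)) ]′ (O-total x x∈S)

      uncr-avoid : ∀ {σ τ} → Uncr adj k σ τ → (∀ x → x ∈ₗ σ → InS adj k x) →
                   (∀ x → x ∈ₗ τ → O x) → ∀ x → x ∈ₗ σ → O x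
      uncr-avoid (done eq) σ⊆S τ⊆O x x∈ = τ⊆O x (to (eq x) x∈)
      uncr-avoid (step {ρ = ρ} (x₁ , x₂ , x₁∈ , x₂∈ , _ , x₁∧x₂*∈S , eq) u) σ⊆S τ⊆O = σ⊆O
        where
        ρ⊆S : ∀ y → y ∈ₗ ρ → InS adj k y
        ρ⊆S y y∈ with to (eq y) y∈
        ... | inj₁ (y∈σ , _)   = σ⊆S y y∈σ
        ... | inj₂ (inj₁ refl) = x₁∧x₂*∈S
        ... | inj₂ (inj₂ refl) = σ⊆S y x₂∈

        ρ⊆O : ∀ y → y ∈ₗ ρ → O y
        ρ⊆O = uncr-avoid u ρ⊆S τ⊆O

        σ⊆O : ∀ y → y ∈ₗ _ → O y
        σ⊆O y y∈ with y ≟ₛ x₁ | y ≟ₛ x₂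
        ... | yes refl | _        = O-∧ x₁ x₂ (σ⊆S x₁ x₁∈) (ρ⊆O x₂ (from (eq x₂) (inj₂ (inj₂ refl))))
                                      (ρ⊆O _ (from (eq _) (inj₂ (inj₁ refl))))
        ... | no _     | yes refl = ρ⊆O x₂ (from (eq x₂) (inj₂ (inj₂ refl)))
        ... | no y≢x₁  | no y≢x₂  = ρ⊆O y (from (eq y) (inj₁ (y∈ , y≢x₁ , y≢x₂)))

      -- A profile excludes a tree.

      module _ {Fstar : Fam} (uncrossing : IsUncrossingOf adj k (Pk adj k) Fstar) where

        hat-avoid : ∀ {τ} → Hat adj k Fstar τ → ¬ (∀ x → x ∈ₗ τ → O x)
        hat-avoid {τ} (base Fτ) τ⊆O with proj₁ uncrossing τ Fτ
        ... | _ , σ , (σP , σ⊆S) , u = proj₂ (proj₂ profile) σ σP (uncr-avoid u σ⊆S τ⊆O)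
        hat-avoid (shift {r} {s} {τ} {τ′} h _ _ _ _ (s∈S , r≤s , _) (_ , τ-dom , (x , x∈ , r≤x) , eq)) τ′⊆O =
          hat-avoid h τ⊆O
          where
          -- The star has a member above r, and its image lies above s; this brings s into `O`.
          Os : O s
          Os = O-down s (x ∨ₛ s) s∈S (y≤x∨y x s) (τ′⊆O _ (from (eq _) (x , x∈ , inj₁ (r≤x , refl))))

          τ⊆O : ∀ y → y ∈ₗ τ → O y
          τ⊆O y y∈ with r ≤ₛ? y
          ... | yes r≤y = O-down y (y ∨ₛ s) (proj₁ (τ-dom y y∈)) (x≤x∨y y s)
                            (τ′⊆O _ (from (eq _) (y , y∈ , inj₁ (r≤y , refl))))
          ... | no  r≰y = O-∧ y s (proj₁ (τ-dom y y∈)) Os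
                            (τ′⊆O _ (from (eq _) (y , y∈ , inj₂ (r≰y , refl))))

        bar-avoid : ∀ {τ} → Bar adj k Fstar τ → ¬ (∀ x → x ∈ₗ τ → O x)
        bar-avoid (inj₁ h) τ⊆O = hat-avoid h τ⊆O
        bar-avoid (inj₂ (x , _ , small , refl)) τ⊆O = small*∉O x small (τ⊆O x (here refl))

        no-tree : ¬ SkTree adj k (Bar adj k Fstar)
        no-tree T = at-sink (last-or-none (λ i → O-total (β i) (β∈S i)))
          where
          open SkTree T

          at-node : ∀ t → ¬ (∀ x → (∃[ i ] (parent i ≡ t) × (x ≡ β i))
                                  ⊎ (∃[ j ] (t ≡ suc j) × (x ≡ (β j) *)) → O x)
          at-node t t⊆O with nodes t
          ... | τ , τ∈ , eq = bar-avoid τ∈ λ x x∈ → t⊆O x (to (eq x) x∈)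

          at-sink : _ → _
          at-sink (inj₁ all) = at-node zero λ { x (inj₁ (i , _ , refl)) → all i }
          at-sink (inj₂ (j , Oj , after)) = at-node (suc j) λ
            { x (inj₁ (i , eq , refl)) → after i (subst (λ t → toℕ t ≤ toℕ i) eq (parent< i))
            ; x (inj₂ (.j , refl , refl)) → Oj }

    -- Rooted trees and grafting.

    Incoming : ∀ {m} → (Fin m → Fin (suc m)) → (Fin m → OSep n) → Fin (suc m) → Pred (OSep n) 0ℓ
    Incoming parent β t x = ∃[ i ] (parent i ≡ t) × (x ≡ β i)

    ∈ᵖ-resp : ∀ {H : Fam {n}} {P Q : Pred (OSep n) 0ℓ} → (∀ x → P x ⇔ Q x) → P ∈ᵖ H → Q ∈ᵖ H
    ∈ᵖ-resp P⇔Q (σ , σ∈ , eq) = σ , σ∈ , λ x → mk⇔ (to (P⇔Q x) ∘ to (eq x)) (from (eq x) ∘ from (P⇔Q x))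

    -- A tree as in SkTree, except that the root node (index zero) need not satisfy H;
    -- Q is the set of labels pointing at the root.
    record Rooted (H : Fam {n}) (Q : Pred (OSep n) 0ℓ) : Set where
      field
        m       : ℕ
        parent  : Fin m → Fin (suc m)
        parent≤ : ∀ i → toℕ (parent i) ≤ toℕ i
        β       : Fin m → OSep n
        β∈S     : ∀ i → InS adj k (β i)
        inner   : ∀ j → (λ x → Incoming parent β (suc j) x ⊎ x ≡ (β j) *) ∈ᵖ H
        root    : ∀ x → Incoming parent β zero x ⇔ Q x

    rooted-resp : ∀ {H Q R} → (∀ x → Q x ⇔ R x) → Rooted H Q → Rooted H R
    rooted-resp Q⇔R T = record
      { Rooted T
      ; root = λ x → mk⇔ (to (Q⇔R x) ∘ to (Rooted.root T x)) (from (Rooted.root T x) ∘ from (Q⇔R x))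
      }

    leaf : ∀ {H Q} → (∀ x → ¬ Q x) → Rooted H Q
    leaf ¬Q = record
      { m = 0 ; parent = λ () ; parent≤ = λ () ; β = λ () ; β∈S = λ () ; inner = λ ()
      ; root = λ x → mk⇔ (λ ()) (λ q → contradiction q (¬Q x)) }

    rooted⇒skTree : ∀ {H Q} → Q ∈ᵖ H → Rooted H Q → SkTree adj k H
    rooted⇒skTree {H} {Q} Q∈H T = record
      { m = m ; parent = parent ; parent< = parent≤ ; β = β ; β∈S = β∈S ; nodes = nodes }
      where
      open Rooted T

      nodes : ∀ t → (λ x → Incoming parent β t x ⊎ (∃[ j ] (t ≡ suc j) × (x ≡ (β j) *))) ∈ᵖ H
      nodes zero    = ∈ᵖ-resp (λ x → mk⇔ (inj₁ ∘ from (root x)) λ { (inj₁ i) → to (root x) i ; (inj₂ (_ , () , _)) }) Q∈H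
      nodes (suc j) = ∈ᵖ-resp (λ x → mk⇔ [ inj₁ , (λ eq → inj₂ (j , refl , eq)) ]′
                                          [ inj₁ , (λ { (.j , refl , eq) → inj₂ eq }) ]′) (inner j)

    module _ {H : Fam {n}} {Q₁ Q₂ : Pred (OSep n) 0ℓ} (T₁ : Rooted H Q₁) (T₂ : Rooted H Q₂)
             (b : OSep n) (b∈S : InS adj k b) (Q₂∈H : (λ x → Q₂ x ⊎ x ≡ b *) ∈ᵖ H) where

      private
        module T₁ = Rooted T₁
        module T₂ = Rooted T₂

        M : ℕ
        M = T₁.m + suc T₂.m

        -- The edges of `T₁` come first, then the new edge, then the edges of `T₂`. Edge number e
        -- has child node e + 1, so the new edge leads to node `suc T₁.m`, which is the renumbered
        -- root of `T₂`.
        parent⊎ : Fin T₁.m ⊎ Fin (suc T₂.m) → Fin (suc M)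
        parent⊎ (inj₁ i)       = T₁.parent i ↑ˡ suc T₂.m
        parent⊎ (inj₂ zero)    = zero
        parent⊎ (inj₂ (suc j)) = suc T₁.m ↑ʳ T₂.parent j

        β⊎ : Fin T₁.m ⊎ Fin (suc T₂.m) → OSep n
        β⊎ (inj₁ i)       = T₁.β i
        β⊎ (inj₂ zero)    = b
        β⊎ (inj₂ (suc j)) = T₂.β j

        parent : Fin M → Fin (suc M)
        parent e = parent⊎ (splitAt T₁.m e)

        β : Fin M → OSep n
        β e = β⊎ (splitAt T₁.m e)

        edge : Fin T₁.m ⊎ Fin (suc T₂.m) → Fin M
        edge = join T₁.m (suc T₂.m)

        ↑ˡ≢↑ʳ : ∀ {m m′} (i : Fin m) (j : Fin m′) → i ↑ˡ m′ ≢ m ↑ʳ j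
        ↑ˡ≢↑ʳ (suc i) j eq = ↑ˡ≢↑ʳ i j (Fin.suc-injective eq)

        incoming⇔ : ∀ t x → Incoming parent β t x ⇔ (∃[ c ] (parent⊎ c ≡ t) × (x ≡ β⊎ c))
        incoming⇔ t x = mk⇔ (λ (e , p , q) → splitAt T₁.m e , p , q)
          λ (c , p , q) → edge c , trans (cong parent⊎ (splitAt-join T₁.m _ c)) p ,
                                   trans q (sym (cong β⊎ (splitAt-join T₁.m _ c)))

        incoming-inner₁ : ∀ i x → (∃[ c ] (parent⊎ c ≡ suc i ↑ˡ suc T₂.m) × (x ≡ β⊎ c)) ⇔
                                  Incoming T₁.parent T₁.β (suc i) x
        incoming-inner₁ i x = mk⇔
          (λ { (inj₁ i′ , p , q) → i′ , ↑ˡ-injective _ _ _ p , q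
             ; (inj₂ (suc j) , p , q) → contradiction (sym p) (↑ˡ≢↑ʳ (suc i) (T₂.parent j)) })
          (λ (i′ , p , q) → inj₁ i′ , cong (_↑ˡ _) p , q)

        incoming₂ : ∀ t x → (∃[ c ] (parent⊎ c ≡ suc T₁.m ↑ʳ t) × (x ≡ β⊎ c)) ⇔
                            Incoming T₂.parent T₂.β t x
        incoming₂ t x = mk⇔
          (λ { (inj₁ i , p , q) → contradiction p (↑ˡ≢↑ʳ (T₁.parent i) t)
             ; (inj₂ (suc j) , p , q) → j , ↑ʳ-injective (suc T₁.m) _ _ p , q })
          (λ (j , p , q) → inj₂ (suc j) , cong (suc T₁.m ↑ʳ_) p , q)

        incoming-root : ∀ x → (∃[ c ] (parent⊎ c ≡ zero) × (x ≡ β⊎ c)) ⇔ (Q₁ x ⊎ x ≡ b)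
        incoming-root x = mk⇔
          (λ { (inj₁ i , p , q) → inj₁ (to (T₁.root x) (i , ↑ˡ-injective _ _ zero p , q))
             ; (inj₂ zero , p , q) → inj₂ q })
          (λ { (inj₁ q₁) → let i , p , q = from (T₁.root x) q₁ in inj₁ i , cong (_↑ˡ _) p , q
             ; (inj₂ q) → inj₂ zero , refl , q })

        toℕ-parent⊎ : ∀ c → toℕ (parent⊎ c) ≤ toℕ (edge c)
        toℕ-parent⊎ (inj₁ i) = subst₂ _≤_ (sym (toℕ-↑ˡ (T₁.parent i) _)) (sym (toℕ-↑ˡ i _)) (T₁.parent≤ i)
        toℕ-parent⊎ (inj₂ zero) = z≤n
        toℕ-parent⊎ (inj₂ (suc j)) =
          subst₂ _≤_ (sym (toℕ-↑ʳ (suc T₁.m) (T₂.parent j)))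
                     (trans (sym (+-suc T₁.m (toℕ j))) (sym (toℕ-↑ʳ T₁.m (suc j))))
                     (s≤s (+-monoʳ-≤ T₁.m (T₂.parent≤ j)))

        β⊎∈S : ∀ c → InS adj k (β⊎ c)
        β⊎∈S (inj₁ i)       = T₁.β∈S i
        β⊎∈S (inj₂ zero)    = b∈S
        β⊎∈S (inj₂ (suc j)) = T₂.β∈S j

        inner⊎ : ∀ c → (λ x → (∃[ c′ ] (parent⊎ c′ ≡ suc (edge c)) × (x ≡ β⊎ c′)) ⊎ x ≡ (β⊎ c) *) ∈ᵖ H
        inner⊎ (inj₁ i)       = ∈ᵖ-resp (λ x → ⇔-sym (incoming-inner₁ i x) ⊎-⇔ ⇔-id _) (T₁.inner i)
        inner⊎ (inj₂ zero)    =
          ∈ᵖ-resp (λ x → ⇔-sym (T₂.root x ⇔-∘ incoming₂ zero x) ⊎-⇔ ⇔-id _) Q₂∈H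
        inner⊎ (inj₂ (suc j)) = ∈ᵖ-resp (λ x → ⇔-sym (incoming₂ (suc j) x) ⊎-⇔ ⇔-id _) (T₂.inner j)

      -- `T₂` is hung below the root of `T₁`. Its own root becomes an inner node, whose labels are
      -- those of `Q₂` and the inverse of `b`; this is why that set has to lie in `H`.
      graft : Rooted H (λ x → Q₁ x ⊎ x ≡ b)
      graft = record
        { m = M ; parent = parent
        ; parent≤ = λ e → subst (λ e′ → toℕ (parent e) ≤ toℕ e′) (join-splitAt T₁.m _ e)
                                (toℕ-parent⊎ (splitAt T₁.m e))
        ; β = β
        ; β∈S = λ e → β⊎∈S (splitAt T₁.m e)
        ; inner = λ e → ∈ᵖ-resp (λ x → ⇔-sym (incoming⇔ (suc e) x) ⊎-⇔ ⇔-id _)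
            (subst (λ e′ → (λ x → (∃[ c ] (parent⊎ c ≡ suc e′) × (x ≡ β⊎ c)) ⊎ x ≡ (β e) *) ∈ᵖ H)
                   (join-splitAt T₁.m _ e) (inner⊎ (splitAt T₁.m e)))
        ; root = λ x → incoming-root x ⇔-∘ incoming⇔ zero x
        }

    -- Separations emulating from both ends.

    -- Emulation by a separation of minimum order between r and t, by submodularity.
    minimum-emulates : ∀ r s t → InS adj k s → r ≤ₛ s → s ≤ₛ t →
      (∀ y → InS adj k y → r ≤ₛ y → y ≤ₛ t → order s ≤ order y) → Emulates adj k s r
    minimum-emulates r s t s∈S r≤s s≤t min = s∈S , r≤s , image⊆S
      where
      ∨∈S : ∀ y → InS adj k y → r ≤ₛ y → InS adj k (y ∨ₛ s)
      ∨∈S y y∈S@(sy , oy) r≤y = isSep-∨ y s sy (proj₁ s∈S) ,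
        ≤-<-trans (+-cancelˡ-≤ (order s) _ _ (begin
          order s + order (y ∨ₛ s)        ≤⟨ +-monoˡ-≤ (order (y ∨ₛ s)) s≤∧ ⟩
          order (y ∧ₛ s) + order (y ∨ₛ s) ≤⟨ order-submodular y s ⟩
          order y + order s               ≡⟨ ℕ.+-comm (order y) (order s) ⟩
          order s + order y               ∎)) oy
        where
        open ≤-Reasoning

        s≤∧ : order s ≤ order (y ∧ₛ s)
        -- Minimality speaks only of separations of order below `k`; assuming the meet to have
        -- smaller order than s makes it one of them.
        s≤∧ = ≮⇒≥ λ ∧<s → <⇒≱ ∧<s
          (min (y ∧ₛ s) (isSep-∧ y s sy (proj₁ s∈S) , <-trans ∧<s (proj₂ s∈S))
               (∧-greatest y s r r≤y r≤s) (≤ₛ-trans (y ∧ₛ s) s t (x∧y≤y y s) s≤t))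

      image⊆S : ∀ y z → GeqDom adj k r y → ShiftMap adj k r s y z → InS adj k z
      image⊆S y z (y∈S , _)           (inj₁ (r≤y , refl)) = ∨∈S y y∈S r≤y
      image⊆S y z (y∈S , inj₁ r≤y , _)  (inj₂ (r≰y , refl)) = contradiction r≤y r≰y
      image⊆S y z (y∈S , inj₂ r≤y* , _) (inj₂ (_ , refl))   =
        inS-* ((y *) ∨ₛ s) (∨∈S (y *) (inS-* y y∈S) r≤y*)

    -- One separation of minimum order serves both ends, because inversion reverses `≤ₛ` and
    -- preserves `order`.
    separator : ∀ r t → InS adj k r → InS adj k t → r ≤ₛ t →
                ∃[ s ] (Emulates adj k s r × Emulates adj k (s *) (t *))
    separator r t r∈S t∈S r≤t
      with minimal (λ y → inS? y ×-dec ((r ≤ₛ? y) ×-dec (y ≤ₛ? t))) order (r , r∈S , ≤ₛ-refl r , r≤t)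
    ... | s , (s∈S , r≤s , s≤t) , min = s ,
      minimum-emulates r s t s∈S r≤s s≤t (λ y y∈S r≤y y≤t → min y (y∈S , r≤y , y≤t)) ,
      minimum-emulates (t *) (s *) (r *) (inS-* s s∈S) (swap s≤t) (swap r≤s) λ y y∈S t*≤y y≤r* →
        subst₂ _≤_ (sym (order-* s)) (order-* y) (min (y *) (inS-* y y∈S , swap y≤r* , swap t*≤y))

    -- From forced separations to trees.

    module _ (Fstar : Fam {n}) (uncrossing : IsUncrossingOf adj k (Pk adj k) Fstar) where

      -- Forced P x: some tree over Hat Fstar and the singletons {p *}, p ∈ P, with one
      -- dangling edge shows that every orientation of S containing P and avoiding Hat Fstar contains x.
      data Forced (P : Pred (OSep n) 0ℓ) : Pred (OSep n) 0ℓ where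
        assumed : ∀ {x} → P x → Forced P x
        node    : ∀ {τ x} → Hat adj k Fstar τ → x ∈ₗ τ →
                  (∀ y → y ∈ₗ τ → y ≢ x → Forced P y) → Forced P (x *)

      -- Two partial trees whose dangling edges carry opposite labels can be joined along that edge,
      -- which leaves no dangling edge.
      Conflict : Pred (OSep n) 0ℓ → Set
      Conflict P = ∃[ x ] (Forced P x × Forced P (x *))

      fstar⊆S : ∀ {τ} → Fstar τ → ∀ x → x ∈ₗ τ → InS adj k x
      fstar⊆S Fτ with proj₂ (proj₁ uncrossing _ Fτ)
      ... | _ , (_ , σ⊆S) , u = uncr-invariant (InS adj k) (λ _ _ _ _ z → z) u σ⊆S

      hat⊆S : ∀ {τ} → Hat adj k Fstar τ → ∀ x → x ∈ₗ τ → InS adj k x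
      hat⊆S (base Fτ) x x∈ = fstar⊆S Fτ x x∈
      hat⊆S (shift _ _ _ _ _ (_ , _ , image⊆S) (_ , dom , _ , eq)) z z∈ with to (eq z) z∈
      ... | y , y∈ , fy = image⊆S y z (dom y y∈) fy

      SmallInS : Pred (OSep n) 0ℓ
      SmallInS x = InS adj k x × Small x

      H : Fam {n}
      H = Bar adj k Fstar

      -- The tree behind `Forced`: its root becomes a valid node once the dangling edge is attached,
      -- and x is the label of that edge pointing out of the branch.
      Branch : OSep n → Set₁
      Branch x = ∃[ Q ] (Rooted H Q × InS adj k x × (λ y → Q y ⊎ y ≡ x *) ∈ᵖ H)

      -- A repeated entry of the list yields several parallel branches. This does no harm, as the
      -- labels at a node are compared as a set.
      children : ∀ z xs → (∀ y → y ∈ₗ xs → y ≢ z → Branch y) → Rooted H (λ y → y ∈ₗ xs × y ≢ z)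
      children z []       branches = leaf λ { _ (() , _) }
      children z (y ∷ ys) branches with children z ys (λ w → branches w ∘ there) | y ≟ₛ z
      ... | T | yes refl = rooted-resp
        (λ w → mk⇔ (λ (w∈ , w≢z) → there w∈ , w≢z)
                    λ { (here eq , w≢z) → contradiction eq w≢z ; (there w∈ , w≢z) → w∈ , w≢z }) T
      ... | T | no y≢z with branches y (here refl) y≢z
      ...   | Q , T′ , y∈S , Q∈H = rooted-resp
        (λ w → mk⇔ (λ { (inj₁ (w∈ , w≢z)) → there w∈ , w≢z ; (inj₂ refl) → here refl , y≢z })
                    λ { (here eq , _) → inj₂ eq ; (there w∈ , w≢z) → inj₁ (w∈ , w≢z) })
        (graft T T′ y y∈S Q∈H)

      branch : ∀ {x} → Forced SmallInS x → Branch x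
      branch {x} (assumed (x∈S , small)) = (λ _ → ⊥) , leaf (λ _ z → z) , x∈S ,
        (x * ∷ [] , inj₂ (x * , inS-* x x∈S , small , refl) ,
         λ y → mk⇔ (λ { (here eq) → inj₂ eq }) λ { (inj₂ eq) → here eq })
      branch (node {τ} {x} τ∈ x∈ sub) = (λ y → y ∈ₗ τ × y ≢ x) ,
        children x τ (λ y y∈ y≢x → branch (sub y y∈ y≢x)) , inS-* x (hat⊆S τ∈ x x∈) ,
        (τ , inj₁ τ∈ , λ y → mk⇔ (split y) λ { (inj₁ (y∈ , _)) → y∈ ; (inj₂ refl) → x∈ })
        where
        split : ∀ y → y ∈ₗ τ → (y ∈ₗ τ × y ≢ x) ⊎ y ≡ x
        split y y∈ with y ≟ₛ x
        ... | yes eq = inj₂ eq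
        ... | no  ne = inj₁ (y∈ , ne)

      conflict⇒skTree : Conflict SmallInS → SkTree adj k H
      conflict⇒skTree (x , fx , fx*) with branch fx | branch fx*
      ... | Q , T , x∈S , Q∈H | Q′ , T′ , _ , Q′∈H = rooted⇒skTree Q′∈H (graft T′ T x x∈S Q∈H)

      -- Stars under shifting, and removal of an assumption.

      module _ (k≤n : k ≤ n) where

        -- At most one member of a star lies above a nontrivial r. A shift joins it with s and meets
        -- every other member with s *, which keeps the members pointing towards each other.
        hat-star : ∀ {τ} → Hat adj k Fstar τ → IsStar τ
        hat-star (base Fτ) = proj₁ (proj₁ uncrossing _ Fτ)
        hat-star h@(shift {r} {s} {τ} {τ′} _ _ nontriv _ _ (_ , r≤s , _) ((_ , star) , dom , _ , eq)) =
          (λ x x∈ → inS⇒nondegenerate k≤n x (hat⊆S h x x∈)) , star′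
          where
          star′ : ∀ z z′ → z ∈ₗ τ′ → z′ ∈ₗ τ′ → z ≢ z′ → z ≤ₛ (z′ *)
          star′ z z′ z∈ z′∈ z≢z′ with to (eq z) z∈ | to (eq z′) z′∈
          ... | y , y∈ , inj₁ (r≤y , refl) | y′ , y′∈ , inj₁ (r≤y′ , refl) =
            contradiction (trans (r≡ y y∈ r≤y (≤ₛ-trans r y′ (y *) r≤y′ (swap y≤y′*)))
                                 (sym (r≡ y′ y′∈ r≤y′ (≤ₛ-trans r y (y′ *) r≤y y≤y′*)))) y≢y′
            where
            y≢y′ : y ≢ y′
            y≢y′ refl = z≢z′ refl

            y≤y′* : y ≤ₛ (y′ *)
            y≤y′* = star y y′ y∈ y′∈ y≢y′

            -- A member above r whose inverse is also above r makes r trivial unless it is r itself,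
            -- so two members above r would coincide.
            r≡ : ∀ w → w ∈ₗ τ → r ≤ₛ w → r ≤ₛ (w *) → w ≡ r
            r≡ w w∈ r≤w r≤w* with r ≟ₛ w
            ... | yes eq = sym eq
            ... | no r≢w = contradiction
              (w , proj₁ (dom w w∈) , (r≤w , r≢w) ,
               (r≤w* , λ r≡w* → proj₂ (proj₂ (dom w w∈)) (sym (cong _* r≡w*)))) nontriv
          ... | y , y∈ , inj₁ (r≤y , refl) | y′ , y′∈ , inj₂ (r≰y′ , refl) =
            ∨-monoˡ y (y′ *) s (star y y′ y∈ y′∈ λ { refl → r≰y′ r≤y })
          ... | y , y∈ , inj₂ (r≰y , refl) | y′ , y′∈ , inj₁ (r≤y′ , refl) =
            swap (∨-monoˡ y′ (y *) s (star y′ y y′∈ y∈ λ { refl → r≰y r≤y′ }))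
          ... | y , y∈ , inj₂ (_ , refl) | y′ , y′∈ , inj₂ (_ , refl) =
            ≤ₛ-trans (y ∧ₛ (s *)) y ((y′ *) ∨ₛ s) (x∧y≤x y (s *))
              (≤ₛ-trans y (y′ *) ((y′ *) ∨ₛ s) (star y y′ y∈ y′∈ λ { refl → z≢z′ refl }) (x≤x∨y (y′ *) s))

        -- Labels grow towards the dangling edge, so every assumption used in a tree lies below the
        -- separation that it forces.
        branch≤ : ∀ {τ} → Hat adj k Fstar τ → ∀ x y → x ∈ₗ τ → y ∈ₗ τ → y ≢ x → y ≤ₛ (x *)
        branch≤ h x y x∈ y∈ y≢x = proj₂ (hat-star h) y x y∈ x∈ y≢x

        module _ (A : Pred (OSep n) 0ℓ) (r : OSep n) where

          A+r : Pred (OSep n) 0ℓ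
          A+r x = A x ⊎ x ≡ r

          -- The leaf r could occur only in a tree forcing a separation above r.
          discharge : ∀ {x} → ¬ (r ≤ₛ x) → Forced A+r x → Forced A x
          discharge r≰x (assumed (inj₁ a))    = assumed a
          discharge r≰x (assumed (inj₂ refl)) = contradiction (≤ₛ-refl r) r≰x
          discharge r≰x* (node {x = x} h x∈ sub) = node h x∈ λ y y∈ y≢x →
            discharge (λ r≤y → r≰x* (≤ₛ-trans r y (x *) r≤y (branch≤ h x y x∈ y∈ y≢x))) (sub y y∈ y≢x)

          -- Rerooting the tree at its leaf r: at most one branch of a star can lie above r,
          -- since r is not small.
          reroot : ¬ Small r → ∀ {x} → Forced A+r x → Forced A (x *) → Conflict A ⊎ Forced A (r *)
          reroot r-large (assumed {x} (inj₁ a)) fx* = inj₁ (x , assumed a , fx*)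
          reroot r-large (assumed (inj₂ refl))  fr* = inj₂ fr*
          reroot r-large (node {τ} {x} h x∈ sub) fx
            with Any.any? (λ y → (r ≤ₛ? y) ×-dec ¬? (y ≟ₛ x)) τ
          ... | no none = inj₁ (x , fx , node h x∈ λ y y∈ y≢x →
            discharge (λ r≤y → none (lose y∈ (r≤y , y≢x))) (sub y y∈ y≢x))
          ... | yes some with find some
          -- The node is turned around: `fx` now supplies the label x, and the dangling edge moves
          -- to y.
          ...   | y , y∈ , r≤y , y≢x = reroot r-large (sub y y∈ y≢x) (node h y∈ others)
            where
            others : ∀ w → w ∈ₗ τ → w ≢ y → Forced A w
            others w w∈ w≢y with w ≟ₛ x
            ... | yes refl = fx
            ... | no w≢x   = discharge
              (λ r≤w → r-large (between-small r y r≤y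
                (≤ₛ-trans r w (y *) r≤w (branch≤ h y w y∈ w∈ w≢y))))
              (sub w w∈ w≢x)

          -- At most one orientation of x lies above r, so one of the two trees does without the
          -- leaf r. The other one is then rerooted.
          conflict-discharge : ¬ Small r → Conflict A+r → Conflict A ⊎ Forced A (r *)
          conflict-discharge r-large (x , fx , fx*) with r ≤ₛ? x
          ... | no r≰x  = reroot r-large fx* (discharge r≰x fx)
          ... | yes r≤x = reroot r-large fx (discharge (λ r≤x* → r-large (between-small r x r≤x r≤x*)) fx*)

        -- Shifting a whole tree.

        module _ (A : Pred (OSep n) 0ℓ) (A⊆S : ∀ x → A x → InS adj k x)
                 (A-down : ∀ x y → InS adj k x → x ≤ₛ y → A y → A x)
                 (r s : OSep n) (r∈S : InS adj k r) (r-large : ¬ Small r) (emulates : Emulates adj k s r) where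

          private
            image⊆S : ∀ y z → GeqDom adj k r y → ShiftMap adj k r s y z → InS adj k z
            image⊆S = proj₂ (proj₂ emulates)

            r≤s : r ≤ₛ s
            r≤s = proj₁ (proj₂ emulates)

            ≤r*⇒r≰ : ∀ y → y ≤ₛ (r *) → ¬ (r ≤ₛ y)
            ≤r*⇒r≰ y y≤r* r≤y = r-large (between-small r y r≤y (swap y≤r*))

            shiftFun : OSep n → OSep n
            shiftFun y with r ≤ₛ? y
            ... | yes _ = y ∨ₛ s
            ... | no  _ = y ∧ₛ (s *)

            shiftFun-map : ∀ y → ShiftMap adj k r s y (shiftFun y)
            shiftFun-map y with r ≤ₛ? y
            ... | yes r≤y = inj₁ (r≤y , refl)
            ... | no r≰y  = inj₂ (r≰y , refl)

            shiftMap⇒≡ : ∀ y z → ShiftMap adj k r s y z → z ≡ shiftFun y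
            shiftMap⇒≡ y z fy with r ≤ₛ? y | fy
            ... | yes _   | inj₁ (_ , eq)   = eq
            ... | yes r≤y | inj₂ (r≰y , _)  = contradiction r≤y r≰y
            ... | no r≰y  | inj₁ (r≤y , _)  = contradiction r≤y r≰y
            ... | no _    | inj₂ (_ , eq)   = eq

            map-isShift : ∀ τ z → (z ∈ₗ map shiftFun τ) ⇔ (∃[ y ] (y ∈ₗ τ) × ShiftMap adj k r s y z)
            map-isShift τ z = mk⇔ there′ λ (y , y∈ , fy) →
              subst (_∈ₗ map shiftFun τ) (sym (shiftMap⇒≡ y z fy)) (∈-map⁺ shiftFun y∈)
              where
              there′ : z ∈ₗ map shiftFun τ → ∃[ y ] (y ∈ₗ τ) × ShiftMap adj k r s y z
              there′ z∈ with ∈-map⁻ shiftFun z∈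
              ... | y , y∈ , refl = y , y∈ , shiftFun-map y

          r*∧s*≡s* : (r *) ∧ₛ (s *) ≡ s *
          r*∧s*≡s* = ≤ₛ-antisym _ _ (x∧y≤y (r *) (s *)) (∧-greatest (r *) (s *) (s *) (swap r≤s) (≤ₛ-refl (s *)))

          -- The labels directed towards the dangling edge are all met with s *. The assumptions
          -- stay in `A` because it is closed downwards, and every node that is kept becomes its
          -- shift.
          forced-shift : ∀ {y} → Forced A y → y ≤ₛ (r *) → Forced A (y ∧ₛ (s *))
          forced-shift {y} (assumed a) y≤r* = assumed (A-down (y ∧ₛ (s *)) y y∧s*∈S (x∧y≤x y (s *)) a)
            where
            y∧s*∈S : InS adj k (y ∧ₛ (s *))
            y∧s*∈S with y ≟ₛ (r *)
            -- The shift map is undefined at r *, but there the meet is just s *.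
            ... | yes refl = subst (InS adj k) (sym r*∧s*≡s*) (inS-* s (proj₁ emulates))
            ... | no y≢r*  = image⊆S y _ (A⊆S y a , inj₂ (swap y≤r*) , y≢r*) (inj₂ (≤r*⇒r≰ y y≤r* , refl))
          forced-shift (node {τ} {x} h x∈ sub) x*≤r* with Any.any? ((r *) ≟ₛ_) τ
          -- A star containing r * cannot be shifted. The star property then gives r * = x *, so the
          -- node is bypassed in favour of its subtree forcing r *.
          ... | yes r*∈ = subst (λ y → Forced A (y ∧ₛ (s *))) r*≡x*
                            (forced-shift (sub (r *) r*∈ r*≢x) (≤ₛ-refl (r *)))
            where
            r*≢x : r * ≢ x
            r*≢x refl = r-large (swap x*≤r*)

            r*≡x* : r * ≡ x *
            r*≡x* = ≤ₛ-antisym _ _ (branch≤ h x (r *) x∈ r*∈ r*≢x) x*≤r*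
          ... | no r*∉ = node h′ (from (map-isShift τ _) (x , x∈ , inj₁ (swap x*≤r* , refl))) sub′
            where
            below : ∀ y → y ∈ₗ τ → y ≢ x → y ≤ₛ (r *)
            below y y∈ y≢x = ≤ₛ-trans y (x *) (r *) (branch≤ h x y x∈ y∈ y≢x) x*≤r*

            dom : ∀ y → y ∈ₗ τ → GeqDom adj k r y
            dom y y∈ = hat⊆S h y y∈ , comparable , λ { refl → r*∉ y∈ }
              where
              comparable : (r ≤ₛ y) ⊎ (r ≤ₛ (y *))
              comparable with y ≟ₛ x
              ... | yes refl = inj₁ (swap x*≤r*)
              ... | no y≢x   = inj₂ (swap (below y y∈ y≢x))

            h′ : Hat adj k Fstar (map shiftFun τ)
            h′ = shift h r∈S (r-large ∘ trivial⇒small r) (r-large ∘ degenerate⇒small r)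
              (r-large ∘ degenerate⇒small r ∘ forced⇒degenerate r) emulates
              (hat-star h , dom , (x , x∈ , swap x*≤r*) , map-isShift τ)

            sub′ : ∀ z → z ∈ₗ map shiftFun τ → z ≢ x ∨ₛ s → Forced A z
            sub′ z z∈ z≢ with to (map-isShift τ z) z∈
            ... | y , y∈ , fy with y ≟ₛ x | fy
            ...   | yes refl | inj₁ (_ , refl)   = contradiction refl z≢
            ...   | yes refl | inj₂ (r≰x , _)    = contradiction (swap x*≤r*) r≰x
            ...   | no y≢x   | inj₁ (r≤y , _)    = contradiction r≤y (≤r*⇒r≰ y (below y y∈ y≢x))
            ...   | no y≢x   | inj₂ (_ , refl)   = forced-shift (sub y y∈ y≢x) (below y y∈ y≢x)

        -- Both forced separations are moved to a separation s between r and t, where they conflict.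
        glue : (A : Pred (OSep n) 0ℓ) (A⊆S : ∀ x → A x → InS adj k x)
               (A-down : ∀ x y → InS adj k x → x ≤ₛ y → A y → A x) → ∀ r t →
               InS adj k r → InS adj k t → ¬ Small r → ¬ Small t → r ≤ₛ (t *) →
               Forced A (r *) → Forced A (t *) → Conflict A
        glue A A⊆S A-down r t r∈S t∈S r-large t-large r≤t* fr* ft* with separator r (t *) r∈S (inS-* t t∈S) r≤t*
        ... | s , s-emulates-r , s*-emulates-t = s ,
          subst (Forced A) (r*∧s*≡s* A A⊆S A-down t (s *) t∈S t-large s*-emulates-t)
            (forced-shift A A⊆S A-down t (s *) t∈S t-large s*-emulates-t ft* (≤ₛ-refl (t *))) ,
          subst (Forced A) (r*∧s*≡s* A A⊆S A-down r s r∈S r-large s-emulates-r)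
            (forced-shift A A⊆S A-down r s r∈S r-large s-emulates-r fr* (≤ₛ-refl (r *)))

        -- The induction on downward closed sets.

        minimal-outside : ∀ {A} → Decidable A → ∀ s → InS adj k s → ¬ A s →
          ∃[ r ] (InS adj k r × r ≤ₛ s × ¬ A r × (∀ x → InS adj k x → x ≤ₛ r → x ≢ r → A x))
        minimal-outside {A} A? s s∈S s∉A
          with minimal (λ x → inS? x ×-dec ((x ≤ₛ? s) ×-dec ¬? (A? x))) height (s , s∈S , ≤ₛ-refl s , s∉A)
        ... | r , (r∈S , r≤s , r∉A) , min = r , r∈S , r≤s , r∉A , λ x x∈S x≤r x≢r →
          decidable-stable (A? x) λ x∉A → x≢r (≤ₛ∧height≥⇒≡ x r x≤r
            (min x (x∈S , ≤ₛ-trans x r s x≤r r≤s , x∉A)))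

        -- All pairs of subsets are counted, separations or not; adding an element to `A` still
        -- lowers the number.
        missing : ∀ {A : Pred (OSep n) 0ℓ} → Decidable A → ℕ
        missing A? = length (filter (¬? ∘ A?) (osep-list n))

        total⇒profile⊎conflict : ∀ A → Decidable A → (∀ x → A x → InS adj k x) →
          (∀ x y → InS adj k x → x ≤ₛ y → A y → A x) →
          (∀ s → InS adj k s → A s ⊎ A (s *)) → HasProfile adj k ⊎ Conflict A
        total⇒profile⊎conflict A A? A⊆S A-down total
          with anyOSep? (λ s → A? s ×-dec A? (s *))
             | anyOSep? (λ x → anyOSep? λ y → A? x ×-dec (A? y ×-dec A? ((x ∨ₛ y) *)))
        ... | yes (s , s∈A , s*∈A) | _ = inj₂ (s , assumed s∈A , assumed s*∈A)
        ... | no _ | yes (x , y , x∈A , y∈A , xy∈A)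
          with proj₂ uncrossing (triple x y)
                 (triple-isP x y (proj₁ (A⊆S x x∈A)) (proj₁ (A⊆S y y∈A)) ,
                  λ z → A⊆S z ∘ triple-all x y x∈A y∈A xy∈A z)
        ...   | τ , Fτ , u with uncr-nonempty u (x , here refl)
        -- Uncrossing puts smaller separations in place of members, so τ lies in `A`; z is then
        -- assumed, while the star τ forces its inverse.
        ...     | z , z∈ = inj₂ (z , assumed (τ⊆A z z∈) , node (base Fτ) z∈ λ w w∈ _ → assumed (τ⊆A w w∈))
          where
          τ⊆A : ∀ z → z ∈ₗ τ → A z
          τ⊆A = uncr-invariant A (λ v w v∈A _ v∧w*∈S → A-down _ v v∧w*∈S (x∧y≤x v (w *)) v∈A) u
            (triple-all x y x∈A y∈A xy∈A)
        total⇒profile⊎conflict A A? A⊆S A-down total | no antisym | no no-triple = inj₁ (A ,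
          (A⊆S , total , λ s s∈A s*∈A → contradiction (s , s∈A , s*∈A) antisym) ,
          (λ x y x*∈A y∈A _ (x≤y , _) → antisym (x , A-down x y (inS-* (x *) (A⊆S (x *) x*∈A)) x≤y y∈A , x*∈A)) ,
          λ σ σP σ⊆A → let x , y , x∈ , y∈ , xy∈ = isP⇒triple σP in
            no-triple (x , y , σ⊆A x x∈ , σ⊆A y y∈ , σ⊆A _ xy∈))

        profile⊎conflict : ∀ A (A? : Decidable A) → Acc _<_ (missing A?) → (∀ x → A x → InS adj k x) →
          (∀ x → InS adj k x → Small x → A x) →
          (∀ x y → InS adj k x → x ≤ₛ y → A y → A x) → HasProfile adj k ⊎ Conflict A
        profile⊎conflict A A? (acc rs) A⊆S small⊆A A-down
          with anyOSep? (λ s → inS? s ×-dec (¬? (A? s) ×-dec ¬? (A? (s *))))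
        ... | no none = total⇒profile⊎conflict A A? A⊆S A-down total
          where
          total : ∀ s → InS adj k s → A s ⊎ A (s *)
          total s s∈S = decidable-stable (A? s ⊎-dec A? (s *)) λ ¬A →
            none (s , s∈S , ¬A ∘ inj₁ , ¬A ∘ inj₂)
        ... | yes (s , s∈S , s∉A , s*∉A)
          with minimal-outside A? s s∈S s∉A | minimal-outside A? (s *) (inS-* s s∈S) s*∉A
        ...   | r , r∈S , r≤s , r∉A , r-min | t , t∈S , t≤s* , t∉A , t-min
          with extend r r∈S r∉A r-min | extend t t∈S t∉A t-min
          where
          extend : ∀ r → InS adj k r → ¬ A r → (∀ x → InS adj k x → x ≤ₛ r → x ≢ r → A x) →
                   HasProfile adj k ⊎ (Conflict A ⊎ Forced A (r *))
          extend r r∈S r∉A r-min with profile⊎conflict (A+r A r) A+r? (rs smaller) A+r⊆S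
                                       (λ x x∈S → inj₁ ∘ small⊆A x x∈S) A+r-down
            where
            A+r? : Decidable (A+r A r)
            A+r? x = A? x ⊎-dec (x ≟ₛ r)

            smaller : missing A+r? < missing A?
            smaller = length-filter-< (¬? ∘ A+r?) (¬? ∘ A?) (λ x x∉A+r → x∉A+r ∘ inj₁)
              (∈-osep-list r) (λ r∉A+r → r∉A+r (inj₂ refl)) r∉A

            A+r⊆S : ∀ x → A+r A r x → InS adj k x
            A+r⊆S x (inj₁ x∈A)  = A⊆S x x∈A
            A+r⊆S x (inj₂ refl) = r∈S

            A+r-down : ∀ x y → InS adj k x → x ≤ₛ y → A+r A r y → A+r A r x
            A+r-down x y x∈S x≤y (inj₁ y∈A) = inj₁ (A-down x y x∈S x≤y y∈A)
            A+r-down x y x∈S x≤y (inj₂ refl) with x ≟ₛ r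
            ... | yes eq = inj₂ eq
            -- The minimality of r outside `A` keeps the enlarged set closed downwards.
            ... | no x≢r = inj₁ (r-min x x∈S x≤y x≢r)
          ... | inj₁ p = inj₁ p
          ... | inj₂ c = inj₂ (conflict-discharge A r (r∉A ∘ small⊆A r r∈S) c)
        ...     | inj₁ p        | _             = inj₁ p
        ...     | _             | inj₁ p        = inj₁ p
        ...     | inj₂ (inj₁ c) | _             = inj₂ c
        ...     | _             | inj₂ (inj₁ c) = inj₂ c
        ...     | inj₂ (inj₂ fr*) | inj₂ (inj₂ ft*) = inj₂ (glue A A⊆S A-down r t r∈S t∈S
          (r∉A ∘ small⊆A r r∈S) (t∉A ∘ small⊆A t t∈S) (≤ₛ-trans r s (t *) r≤s (swap t≤s*)) fr* ft*)

      profile⊎tree : HasProfile adj k ⊎ SkTree adj k H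
      profile⊎tree with k ℕ.≤? n
      -- For k > n the separation (V , V) is available; it is small and its own inverse, so it is in
      -- conflict with itself and yields a tree with a single edge.
      ... | no k≰n = inj₂ (conflict⇒skTree ((⊤ , ⊤) , assumed ⊤⊤-small , assumed ⊤⊤-small))
        where
        ⊤⊤-small : SmallInS (⊤ , ⊤)
        ⊤⊤-small = (isSep-⊤ ⊤ , ≤-<-trans (∣p∣≤n (⊤ ∩ ⊤)) (≰⇒> k≰n)) , ≤ₛ-refl (⊤ , ⊤)
      ... | yes k≤n = map₂ conflict⇒skTree (profile⊎conflict k≤n SmallInS small? (<-wellFounded _)
          (λ _ → proj₁) (λ _ → _,_) (λ x y x∈S x≤y (_ , small) → x∈S , small-down x y x≤y small))
        where
        small? : Decidable SmallInS
        small? x = inS? x ×-dec (x ≤ₛ? (x *))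

theorem4p2 : (n : ℕ) (adj : Fin n → Fin n → Bool) (k : ℕ) → 2 < k
    → (Fstar : Fam {n}) → IsUncrossingOf adj k (Pk adj k) Fstar
    → (HasProfile adj k ⊎ SkTree adj k (Bar adj k Fstar))
    × ¬ (HasProfile adj k × SkTree adj k (Bar adj k Fstar))
theorem4p2 n adj k 2<k Fstar uncrossing =
  profile⊎tree adj k Fstar uncrossing ,
  λ ((O , profile) , T) → no-tree adj k 2<k O profile uncrossing T
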